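{- For the Grundy numbers $\mathcal{G}(t,p)$ of one-pile restricted Nim with a pass and $\mathcal{G}(s,t,u,p)$ of three-pile restricted Nim with a pass (rule sequence $f(x)=\lceil x/2\rceil$), the following hold. (i) $\mathcal{G}(s,0,0,1)=\mathcal{G}(0,s,0,1)=\mathcal{G}(0,0,s,1)=\mathcal{G}(s,1)$ for every $s\in Z_{\ge 0}$. (ii) Let $s,t,u\in Z_{\ge 0}$ and suppose that ($s>0$ and $t>0$), or ($t>0$ and $u>0$), or ($u>0$ and $s>0$). Then: (ii.1) for any $m\in Z_{\ge 0}$, if $\mathcal{G}(s,t,u,0)=2m$, then $\mathcal{G}(s,t,u,1)=2m+1$; (ii.2) for any $m\in Z_{\ge 0}$, if $\mathcal{G}(s,t,u,0)=2m+1$, then $\mathcal{G}(s,t,u,1)=2m$.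
   Context: $Z_{\ge 0}$ is the set of non-negative integers and $N$ is the set of positive integers. For a set $S$ of non-negative integers, $\mathrm{mex}(S)$ is the smallest non-negative integer not in $S$. The Grundy number of a position $\mathbf{p}$ of an impartial game is defined recursively by $\mathcal{G}(\mathbf{p})=\mathrm{mex}(\{\mathcal{G}(\mathbf{h}):\mathbf{h}\in \mathrm{move}(\mathbf{p})\})$, where $\mathrm{move}(\mathbf{p})$ is the set of positions reachable from $\mathbf{p}$ in exactly one move. One-pile restricted Nim with a pass: positions are ordered pairs $\{t,p\}$ with $t\in Z_{\ge 0}$ (number of stones) and $p\in\{0,1\}$ ($p=1$ if the pass is still available, $p=0$ otherwise). If $p=1$ and $t>0$, then $\mathrm{move}(t,p)=\{\{t-v,p\}: v\in N,\ v\le\lceil t/2\rceil\}\cup\{\{t,0\}\}$. If $p=0$ or $t=0$, then $\mathrm{move}(t,p)=\{\{t-v,p\}: v\in N,\ v\le\lceil t/2\rceil\}$. Its Grundy number is denoted $\mathcal{G}(t,p)$. Three-pile restricted Nim with a pass: positions are ordered quadruples $\{s,t,u,p\}$ with $s,t,u\in Z_{\ge 0}$ (numbers of stones in the three piles) and $p\in\{0,1\}$ ($p=1$ if the pass is still available, $p=0$ otherwise). Let $$A(s,t,u,p)=\{\{s-v,t,u,p\}: v\in N, v\le\lceil s/2\rceil\}\cup\{\{s,t-v,u,p\}: v\in N, v\le\lceil t/2\rceil\}\cup\{\{s,t,u-v,p\}: v\in N, v\le\lceil u/2\rceil\}.$$ If $p=1$ and $s+t+u>0$, then $\mathrm{move}(s,t,u,p)=A(s,t,u,p)\cup\{\{s,t,u,0\}\}$.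 If $p=0$ or $s+t+u=0$, then $\mathrm{move}(s,t,u,p)=A(s,t,u,p)$. Its Grundy number is denoted $\mathcal{G}(s,t,u,p)$. -}

module Defs where

open import Data.Fin using (Fin; toℕ)
open import Data.Fin.Patterns using (0F; 1F)
open import Data.List using (List; []; _∷_; _++_; map; upTo)
open import Data.List.Extrema.Nat using (max; xs≤max)
open import Data.List.Membership.DecPropositional using (_∈?_)
open import Data.List.Membership.Propositional using (_∈_; _∉_; mapWith∈)
open import Data.List.Membership.Propositional.Properties
  using (∈-++⁻; ∈-map⁻; mapWith∈-cong; mapWith∈≗map)
open import Data.List.Relation.Unary.All using (lookup)
open import Data.List.Relation.Unary.Any using (here)
open import Data.Nat
open import Data.Nat.Induction using (<-wellFounded)
open import Data.Nat.Properties
open import Data.Product using (_×_; _,_)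
open import Data.Sum using (inj₁; inj₂)
open import Induction.WellFounded
  using (WellFounded; WfRec; module All; module FixPoint; module Subrelation)
open import Relation.Binary.Construct.On using (wellFounded)
open import Relation.Binary.PropositionalEquality
  using (_≡_; refl; trans; cong; subst)
open import Relation.Nullary using (yes; no)

------------------------------------------------------------------------
-- Minimum excluded value

-- Tries k, k + 1, …, k + fuel in turn.
mexFrom : (fuel k : ℕ) → List ℕ → ℕ
mexFrom zero       k xs = k
mexFrom (suc fuel) k xs with _∈?_ _≟_ k xs
... | yes _ = mexFrom fuel (suc k) xs
... | no  _ = k

-- No element of xs exceeds its maximum, so this much fuel suffices.
mex : List ℕ → ℕ
mex xs = mexFrom (suc (max 0 xs)) 0 xs

IsMex : List ℕ → ℕ → Set
IsMex xs m = m ∉ xs × (∀ {j} → j < m → j ∈ xs)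

mexFrom-isMex : ∀ fuel k xs → fuel + k ∉ xs → (∀ {j} → j < k → j ∈ xs) →
                IsMex xs (mexFrom fuel k xs)
mexFrom-isMex zero       k xs top∉ below = top∉ , below
mexFrom-isMex (suc fuel) k xs top∉ below with _∈?_ _≟_ k xs
... | no  k∉ = k∉ , below
... | yes k∈ = mexFrom-isMex fuel (suc k) xs
                 (λ top∈ → top∉ (subst (_∈ xs) (+-suc fuel k) top∈))
                 below′
  where
  below′ : ∀ {j} → j < suc k → j ∈ xs
  below′ j<1+k with m≤n⇒m<n∨m≡n (s≤s⁻¹ j<1+k)
  ... | inj₁ j<k  = below j<k
  ... | inj₂ refl = k∈

mex-isMex : ∀ xs → IsMex xs (mex xs)
mex-isMex xs = mexFrom-isMex (suc (max 0 xs)) 0 xs top∉ (λ ())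
  where
  top∉ : suc (max 0 xs) + 0 ∉ xs
  top∉ top∈ = <⇒≱ (n<1+n (max 0 xs))
    (subst (_≤ max 0 xs) (+-identityʳ _) (lookup (xs≤max 0 xs) top∈))

------------------------------------------------------------------------
-- Impartial games and Grundy numbers

record ImpartialGame : Set₁ where
  field
    Position : Set
    move     : Position → List Position
    move-wf  : WellFounded (λ h p → h ∈ move p)

  _◁_ : Position → Position → Set
  h ◁ p = h ∈ move p

  grundyStep : ∀ p → WfRec _◁_ (λ _ → ℕ) p → ℕ
  grundyStep p rec = mex (mapWith∈ (move p) rec)

  grundy : Position → ℕ
  grundy = All.wfRec move-wf _ (λ _ → ℕ) grundyStep

  grundy-unfold : ∀ p → grundy p ≡ mex (map grundy (move p))
  grundy-unfold p = trans
    (FixPoint.unfold-wfRec move-wf (λ _ → ℕ) grundyStep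
      (λ q {IH} {IH′} eq → cong mex (mapWith∈-cong (move q) IH IH′ eq)))
    (cong mex (mapWith∈≗map grundy (move p)))

------------------------------------------------------------------------
-- Restricted Nim with a pass

-- All n ∸ v with 1 ≤ v ≤ ⌈ n /2⌉.  Since ⌈ n /2⌉ ≤ n, the subtraction
-- never truncates.
removals : ℕ → List ℕ
removals n = map (λ i → n ∸ suc i) (upTo ⌈ n /2⌉)

removals-< : ∀ n {k} → k ∈ removals n → k < n
removals-< zero    ()
removals-< (suc n) k∈
  with ∈-map⁻ (λ i → suc n ∸ suc i) {xs = upTo ⌈ suc n /2⌉} k∈
... | i , _ , refl = s≤s (m∸n≤m n i)

-- The pass flag is 1F while the pass is available and 0F afterwards.
-- `passTo total p x` offers the position x exactly when p = 1 and
-- stones remain.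
passTo : {A : Set} → (total : ℕ) → Fin 2 → A → List A
passTo zero    _  _ = []
passTo (suc _) 0F _ = []
passTo (suc _) 1F x = x ∷ []

passTo⁻ : ∀ {A : Set} total p {x y : A} → y ∈ passTo total p x →
          p ≡ 1F × y ≡ x
passTo⁻ (suc _) 1F (here y≡x) = refl , y≡x

Position₁ : Set
Position₁ = ℕ × Fin 2

move₁ : Position₁ → List Position₁
move₁ (t , p) = map (λ t′ → t′ , p) (removals t) ++ passTo t p (t , 0F)

Position₃ : Set
Position₃ = ℕ × ℕ × ℕ × Fin 2

move₃ : Position₃ → List Position₃
move₃ (s , t , u , p) =
     map (λ s′ → s′ , t , u , p) (removals s)
  ++ map (λ t′ → s , t′ , u , p) (removals t)
  ++ map (λ u′ → s , t , u′ , p) (removals u)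
  ++ passTo (s + t + u) p (s , t , u , 0F)

size₁ : Position₁ → ℕ
size₁ (t , p) = t + toℕ p

size₃ : Position₃ → ℕ
size₃ (s , t , u , p) = s + t + u + toℕ p

move₁-size : ∀ {h} q → h ∈ move₁ q → size₁ h < size₁ q
move₁-size (t , p) h∈ with ∈-++⁻ (map _ (removals t)) h∈
... | inj₁ h∈t with ∈-map⁻ _ h∈t
...   | _ , t′∈ , refl = +-monoˡ-< (toℕ p) (removals-< t t′∈)
move₁-size (t , p) h∈ | inj₂ h∈pass with passTo⁻ t p h∈pass
...   | refl , refl = +-monoʳ-< t (n<1+n 0)

move₃-size : ∀ {h} q → h ∈ move₃ q → size₃ h < size₃ q
move₃-size (s , t , u , p) h∈ with ∈-++⁻ (map _ (removals s)) h∈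
... | inj₁ h∈s with ∈-map⁻ _ h∈s
...   | _ , s′∈ , refl =
        +-monoˡ-< (toℕ p) (+-monoˡ-< u (+-monoˡ-< t (removals-< s s′∈)))
move₃-size (s , t , u , p) h∈ | inj₂ h∈₁ with ∈-++⁻ (map _ (removals t)) h∈₁
... | inj₁ h∈t with ∈-map⁻ _ h∈t
...   | _ , t′∈ , refl =
        +-monoˡ-< (toℕ p) (+-monoˡ-< u (+-monoʳ-< s (removals-< t t′∈)))
move₃-size (s , t , u , p) h∈ | inj₂ h∈₁ | inj₂ h∈₂
  with ∈-++⁻ (map _ (removals u)) h∈₂
... | inj₁ h∈u with ∈-map⁻ _ h∈u
...   | _ , u′∈ , refl =
        +-monoˡ-< (toℕ p) (+-monoʳ-< (s + t) (removals-< u u′∈))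
move₃-size (s , t , u , p) h∈ | inj₂ h∈₁ | inj₂ h∈₂ | inj₂ h∈pass
  with passTo⁻ (s + t + u) p h∈pass
... | refl , refl = +-monoʳ-< (s + t + u) (n<1+n 0)

onePile : ImpartialGame
onePile = record
  { Position = Position₁
  ; move     = move₁
  ; move-wf  = Subrelation.wellFounded (λ {_} {q} → move₁-size q)
                 (wellFounded size₁ <-wellFounded)
  }

threePile : ImpartialGame
threePile = record
  { Position = Position₃
  ; move     = move₃
  ; move-wf  = Subrelation.wellFounded (λ {_} {q} → move₃-size q)
                 (wellFounded size₃ <-wellFounded)
  }

𝒢₁ : ℕ → Fin 2 → ℕ
𝒢₁ t p = ImpartialGame.grundy onePile (t , p)

𝒢₃ : ℕ → ℕ → ℕ → Fin 2 → ℕ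
𝒢₃ s t u p = ImpartialGame.grundy threePile (s , t , u , p)

{-# OPTIONS --safe #-}
-- Write flip for the involution 2m ↔ 2m + 1.  If the option values of q include
-- 𝒢 p and the flipped option values of p, but not flip (𝒢 p), then
-- 𝒢 q = flip (𝒢 p).  This applies inductively to making the pass available, as
-- long as two piles stay non-empty.  The exceptional moves take a whole pile,
-- which then has exactly one stone; by the same principle, without a pass, a
-- one-stone pile also flips the Grundy number.  Hence such a move from p leads
-- to a position whose value without the pass is flip (𝒢 p), so its value with
-- the pass differs from flip (𝒢 p) and does not disturb the mex.
module Submission where

open import Defs
open import Data.Empty using (⊥-elim)
open import Data.Fin using (Fin)
open import Data.Fin.Patterns using (0F; 1F)
open import Data.List using (_++_; map; upTo)
open import Data.List.Membership.Propositional using (_∈_)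
open import Data.List.Membership.Propositional.Properties
  using (∈-++⁺ˡ; ∈-++⁺ʳ; ∈-++⁻; ∈-map⁺; ∈-map⁻; ∈-upTo⁻)
open import Data.List.Properties using (map-++; map-∘)
open import Data.List.Relation.Unary.Any using (here)
open import Data.Nat
  using (ℕ; zero; suc; _+_; _*_; _>_; _<_; s≤s; z<s; s<s; _∸_; ⌈_/2⌉)
open import Data.Nat.Properties
  using ( +-comm; +-assoc; *-suc; m≤m+n; m≤n+m; ≤-trans; <-≤-trans; <-cmp; <⇒≱
        ; m∸n≡0⇒m≤n; ⌈n/2⌉<n)
open import Data.Product using (_×_; _,_; ∃-syntax; proj₁; proj₂)
open import Data.Sum using (_⊎_; inj₁; inj₂)
import Data.Sum as Sum
open import Function using (_∘_)
open import Induction.WellFounded using (Acc; acc)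
open import Relation.Binary.Definitions using (tri<; tri≈; tri>)
open import Relation.Binary.PropositionalEquality
  using (_≡_; _≢_; refl; sym; trans; cong; cong₂; subst; subst₂; module ≡-Reasoning)

-- The involution exchanging 2m and 2m + 1

flip : ℕ → ℕ
flip 0             = 1
flip 1             = 0
flip (suc (suc n)) = suc (suc (flip n))

flip-involutive : ∀ n → flip (flip n) ≡ n
flip-involutive 0             = refl
flip-involutive 1             = refl
flip-involutive (suc (suc n)) = cong (suc ∘ suc) (flip-involutive n)

flip-injective : ∀ {m n} → flip m ≡ flip n → m ≡ n
flip-injective {m} {n} eq =
  trans (sym (flip-involutive m)) (trans (cong flip eq) (flip-involutive n))

n≢flip[n] : ∀ n → n ≢ flip n
n≢flip[n] (suc (suc n)) eq = n≢flip[n] n (cong (_∸ 2) eq)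

<flip⇒≡⊎flip< : ∀ m n → m < flip n → m ≡ n ⊎ flip m < n
<flip⇒≡⊎flip< zero          zero          _ = inj₁ refl
<flip⇒≡⊎flip< (suc m)       zero          (s≤s ())
<flip⇒≡⊎flip< zero          (suc (suc n)) _ = inj₂ (s<s z<s)
<flip⇒≡⊎flip< (suc zero)    (suc (suc n)) _ = inj₂ z<s
<flip⇒≡⊎flip< (suc (suc m)) (suc (suc n)) (s≤s (s≤s m<)) =
  Sum.map (cong (suc ∘ suc)) (s<s ∘ s<s) (<flip⇒≡⊎flip< m n m<)

flip-even : ∀ m → flip (2 * m) ≡ 2 * m + 1
flip-even zero = refl
flip-even (suc m) =
  subst (λ k → flip k ≡ k + 1) (sym (*-suc 2 m)) (cong (suc ∘ suc) (flip-even m))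

flip-odd : ∀ m → flip (2 * m + 1) ≡ 2 * m
flip-odd m = trans (cong flip (sym (flip-even m))) (flip-involutive (2 * m))

-- Grundy values of arbitrary games

IsMex-unique : ∀ {xs m n} → IsMex xs m → IsMex xs n → m ≡ n
IsMex-unique {m = m} {n} (m∉ , below-m) (n∉ , below-n) with <-cmp m n
... | tri< m<n _ _ = ⊥-elim (m∉ (below-n m<n))
... | tri≈ _ m≡n _ = m≡n
... | tri> _ _ n<m = ⊥-elim (n∉ (below-m n<m))

module Grundy (G : ImpartialGame) where
  open ImpartialGame G

  -- An opaque copy of grundy, which keeps unification from unfolding the
  -- well-founded recursion.
  opaque
    value : Position → ℕ
    value = grundy

    value≡grundy : ∀ p → value p ≡ grundy p
    value≡grundy p = refl

    value-isMex : ∀ p → IsMex (map value (move p)) (value p)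
    value-isMex p =
      subst (IsMex _) (sym (grundy-unfold p)) (mex-isMex (map grundy (move p)))

  value-option-≢ : ∀ {p q} → q ∈ move p → value q ≢ value p
  value-option-≢ {p} q∈ eq =
    proj₁ (value-isMex p) (subst (_∈ _) eq (∈-map⁺ value q∈))

  value-option-below : ∀ {p j} → j < value p → ∃[ q ] q ∈ move p × j ≡ value q
  value-option-below {p} j< = ∈-map⁻ value (proj₂ (value-isMex p) j<)

  value-unique : ∀ {p m} → (∀ {q} → q ∈ move p → value q ≢ m) →
                 (∀ {j} → j < m → ∃[ q ] q ∈ move p × j ≡ value q) →
                 value p ≡ m
  value-unique {p} {m} avoids below = IsMex-unique (value-isMex p) (m∉ , m-below)
    where
    m∉ : m ∈ map value (move p) → _
    m∉ m∈ with ∈-map⁻ value m∈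
    ... | q , q∈ , m≡ = avoids q∈ (sym m≡)

    m-below : ∀ {j} → j < m → j ∈ map value (move p)
    m-below j< with below j<
    ... | q , q∈ , refl = ∈-map⁺ value q∈

  -- Each `j` below `flip (value p)` must occur among the option values of `q`. Either `j` is
  -- `value p`, which the last hypothesis supplies, or `flip j` is below `value p`, hence the value
  -- of an option of `p`, and flipping it back gives `j`.
  value-flip : ∀ {p q} →
    (∀ {q′} → q′ ∈ move q → value q′ ≢ flip (value p)) →
    (∀ {p′} → p′ ∈ move p → ∃[ q′ ] q′ ∈ move q × flip (value p′) ≡ value q′) →
    (∃[ q′ ] q′ ∈ move q × value p ≡ value q′) →
    value q ≡ flip (value p)
  value-flip {p} {q} avoids flipped (r , r∈ , p≡r) = value-unique avoids below
    where
    below : ∀ {j} → j < flip (value p) → ∃[ q′ ] q′ ∈ move q × j ≡ value q′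
    below {j} j< with <flip⇒≡⊎flip< j (value p) j<
    ... | inj₁ j≡ = r , r∈ , trans j≡ p≡r
    ... | inj₂ flip[j]< with value-option-below flip[j]<
    ...   | p′ , p′∈ , flip[j]≡ with flipped p′∈
    ...     | q′ , q′∈ , eq =
      q′ , q′∈ , trans (sym (flip-involutive j)) (trans (cong flip flip[j]≡) eq)

module _ (G H : ImpartialGame) where
  private
    module G where
      open ImpartialGame G public
      open Grundy G public
    module H where
      open ImpartialGame H public
      open Grundy H public

  -- The options of `f p` are exactly the images of the options of `p`, so by well-founded induction
  -- both mexes range over the same values.
  value-map : (f : G.Position → H.Position) →
    (∀ {p p′} → p′ ∈ G.move p → f p′ ∈ H.move (f p)) →
    (∀ {p q} → q ∈ H.move (f p) → ∃[ p′ ] p′ ∈ G.move p × q ≡ f p′) →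
    ∀ p → H.value (f p) ≡ G.value p
  value-map f preserves reflects p = go p (G.move-wf p)
    where
    go : ∀ p → Acc G._◁_ p → H.value (f p) ≡ G.value p
    go p (acc rs) = H.value-unique avoids below
      where
      avoids : ∀ {q} → q ∈ H.move (f p) → H.value q ≢ G.value p
      avoids q∈ eq with reflects q∈
      ... | p′ , p′∈ , refl =
        G.value-option-≢ p′∈ (trans (sym (go p′ (rs p′∈))) eq)

      below : ∀ {j} → j < G.value p → ∃[ q ] q ∈ H.move (f p) × j ≡ H.value q
      below j< with G.value-option-below j<
      ... | p′ , p′∈ , j≡ = f p′ , preserves p′∈ , trans j≡ (sym (go p′ (rs p′∈)))

-- Moves of the three-pile game

-- For a pile of at least two stones, half of it rounded up is still less than the whole.
0∈removals⇒≡1 : ∀ n → 0 ∈ removals n → n ≡ 1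
0∈removals⇒≡1 (suc zero)    _  = refl
0∈removals⇒≡1 (suc (suc n)) 0∈
  with ∈-map⁻ (λ i → suc (suc n) ∸ suc i) {xs = upTo ⌈ suc (suc n) /2⌉} 0∈
... | i , i∈ , 0≡ =
  ⊥-elim (<⇒≱ (⌈n/2⌉<n n)
    (≤-trans (m∸n≡0⇒m≤n {suc (suc n)} {suc i} (sym 0≡)) (∈-upTo⁻ i∈)))

Piles : Set
Piles = ℕ × ℕ × ℕ

total : Piles → ℕ
total (s , t , u) = s + t + u

infix 5 _at_
_at_ : Piles → Fin 2 → Position₃
(s , t , u) at p = s , t , u , p

open Grundy threePile

𝒢 : Piles → Fin 2 → ℕ
𝒢 x p = value (x at p)

infix 4 _⟶_
-- Stone removals are kept free of the pass flag, so that the same removal can be replayed with and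
-- without the pass.
data _⟶_ : Piles → Piles → Set where
  first  : ∀ {s s′ t u} → s′ ∈ removals s → (s , t , u) ⟶ (s′ , t , u)
  second : ∀ {s t t′ u} → t′ ∈ removals t → (s , t , u) ⟶ (s , t′ , u)
  third  : ∀ {s t u u′} → u′ ∈ removals u → (s , t , u) ⟶ (s , t , u′)

slide⁺ : ∀ {x y} p → x ⟶ y → y at p ∈ move₃ (x at p)
slide⁺ p (first s′∈) = ∈-++⁺ˡ (∈-map⁺ _ s′∈)
slide⁺ {s , t , u} p (second t′∈) =
  ∈-++⁺ʳ (map _ (removals s)) (∈-++⁺ˡ (∈-map⁺ _ t′∈))
slide⁺ {s , t , u} p (third u′∈) =
  ∈-++⁺ʳ (map _ (removals s)) (∈-++⁺ʳ (map _ (removals t)) (∈-++⁺ˡ (∈-map⁺ _ u′∈)))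

passTo⁺ : ∀ {A : Set} {n} {x : A} → n > 0 → x ∈ passTo n 1F x
passTo⁺ {n = suc _} _ = here refl

pass⁺ : ∀ {x} → total x > 0 → x at 0F ∈ move₃ (x at 1F)
pass⁺ {s , t , u} x>0 =
  ∈-++⁺ʳ (map _ (removals s)) (∈-++⁺ʳ (map _ (removals t))
    (∈-++⁺ʳ (map _ (removals u)) (passTo⁺ x>0)))

passTo-total : ∀ {A : Set} n p {x y : A} → y ∈ passTo n p x → n > 0
passTo-total (suc _) _ _ = z<s

-- A view of membership in `move₃`: matching on it fixes the target position, and the flag index
-- excludes `pass` at `0F`.
data Option (x : Piles) : Fin 2 → Position₃ → Set where
  slide : ∀ {p y} → x ⟶ y → Option x p (y at p)
  pass  : total x > 0 → Option x 1F (x at 0F)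

option : ∀ x p {q} → q ∈ move₃ (x at p) → Option x p q
option (s , t , u) p q∈ with ∈-++⁻ (map _ (removals s)) q∈
... | inj₁ q∈s with ∈-map⁻ _ q∈s
...   | _ , s′∈ , refl = slide (first s′∈)
option (s , t , u) p q∈ | inj₂ q∈₁ with ∈-++⁻ (map _ (removals t)) q∈₁
... | inj₁ q∈t with ∈-map⁻ _ q∈t
...   | _ , t′∈ , refl = slide (second t′∈)
option (s , t , u) p q∈ | inj₂ q∈₁ | inj₂ q∈₂ with ∈-++⁻ (map _ (removals u)) q∈₂
... | inj₁ q∈u with ∈-map⁻ _ q∈u
...   | _ , u′∈ , refl = slide (third u′∈)
option (s , t , u) p q∈ | inj₂ q∈₁ | inj₂ q∈₂ | inj₂ q∈p
  with passTo-total (s + t + u) p q∈p | passTo⁻ (s + t + u) p q∈p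
... | x>0 | refl , refl = pass x>0

-- Pile permutations and the one-pile embedding

module Symmetry (σ : Piles → Piles) (σ-involutive : ∀ x → σ (σ x) ≡ x)
  (σ-slide : ∀ {x y} → x ⟶ y → σ x ⟶ σ y) (σ-total : ∀ x → total (σ x) ≡ total x)
  where

  lift : Position₃ → Position₃
  lift (s , t , u , p) = σ (s , t , u) at p

  lift-involutive : ∀ q → lift (lift q) ≡ q
  lift-involutive (s , t , u , p) = cong (_at p) (σ-involutive (s , t , u))

  lift-move : ∀ {p q} → q ∈ move₃ p → lift q ∈ move₃ (lift p)
  lift-move {s , t , u , p} q∈ with option (s , t , u) p q∈
  ... | slide x⟶y = slide⁺ p (σ-slide x⟶y)
  ... | pass x>0  = pass⁺ (subst (_> 0) (sym (σ-total (s , t , u))) x>0)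

  𝒢-invariant : ∀ x p → 𝒢 (σ x) p ≡ 𝒢 x p
  𝒢-invariant x p = value-map threePile threePile lift lift-move
    -- As `lift` is its own inverse, reflecting moves is preserving them once more.
    (λ {r} {q} q∈ → lift q
                  , subst (λ r′ → lift q ∈ move₃ r′) (lift-involutive r) (lift-move q∈)
                  , sym (lift-involutive q))
    (x at p)

𝒢-swap₁₂ : ∀ s t u p → 𝒢 (t , s , u) p ≡ 𝒢 (s , t , u) p
𝒢-swap₁₂ s t u p = Symmetry.𝒢-invariant
  (λ (s , t , u) → t , s , u) (λ _ → refl)
  (λ { (first ∈s) → second ∈s ; (second ∈t) → first ∈t ; (third ∈u) → third ∈u })
  (λ (s , t , u) → cong (_+ u) (+-comm t s)) (s , t , u) p

𝒢-swap₂₃ : ∀ s t u p → 𝒢 (s , u , t) p ≡ 𝒢 (s , t , u) p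
𝒢-swap₂₃ s t u p = Symmetry.𝒢-invariant
  (λ (s , t , u) → s , u , t) (λ _ → refl)
  (λ { (first ∈s) → first ∈s ; (second ∈t) → third ∈t ; (third ∈u) → second ∈u })
  (λ (s , t , u) → trans (+-assoc s u t)
                     (trans (cong (s +_) (+-comm u t)) (sym (+-assoc s t u))))
  (s , t , u) p

𝒢-single : ∀ t p → 𝒢 (0 , 0 , t) p ≡ Grundy.value onePile (t , p)
𝒢-single t p = value-map onePile threePile embed
  (λ {q} q′∈ → subst (_ ∈_) (sym (embed-move q)) (∈-map⁺ embed q′∈))
  (λ {q} r∈ → ∈-map⁻ embed (subst (_ ∈_) (embed-move q) r∈)) (t , p)
  where
  embed : Position₁ → Position₃
  embed (t , p) = 0 , 0 , t , p

  map-passTo : ∀ {A B : Set} (f : A → B) n p x → passTo n p (f x) ≡ map f (passTo n p x)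
  map-passTo f zero    p  x = refl
  map-passTo f (suc n) 0F x = refl
  map-passTo f (suc n) 1F x = refl

  -- The two empty piles contribute no removals and `0 + 0 + t` computes to `t`, so only
  -- distributing `map embed` remains.
  embed-move : ∀ q → move₃ (embed q) ≡ map embed (move₁ q)
  embed-move (t , p) = trans
    (cong₂ _++_ (map-∘ (removals t)) (map-passTo embed t p (t , 0F)))
    (sym (map-++ embed (map (_, p) (removals t)) (passTo t p (t , 0F))))

-- One-stone piles without a pass

-- Taking the single stone supplies the value of `(0 , t , u)` itself; moves in the other two piles
-- correspond, with flipped values by induction.
𝒢-one : ∀ t u → 𝒢 (1 , t , u) 0F ≡ flip (𝒢 (0 , t , u) 0F)
𝒢-one t u = go t u (ImpartialGame.move-wf threePile _)
  where
  go : ∀ t u → Acc (ImpartialGame._◁_ threePile) (0 , t , u , 0F) →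
       𝒢 (1 , t , u) 0F ≡ flip (𝒢 (0 , t , u) 0F)
  go t u (acc rs) = value-flip avoids flipped
    (_ , slide⁺ 0F (first (here refl)) , refl)
    where
    avoids : ∀ {q} → q ∈ move₃ (1 , t , u , 0F) →
             value q ≢ flip (𝒢 (0 , t , u) 0F)
    avoids q∈ eq with option (1 , t , u) 0F q∈
    ... | slide (first (here refl)) = n≢flip[n] _ eq
    -- Otherwise the same move from `(0 , t , u)` would give an option with the value of
    -- `(0 , t , u)` itself.
    ... | slide (second t′∈) =
      value-option-≢ q′∈ (flip-injective (trans (sym (go _ u (rs q′∈))) eq))
      where q′∈ = slide⁺ 0F (second t′∈)
    ... | slide (third u′∈) =
      value-option-≢ q′∈ (flip-injective (trans (sym (go t _ (rs q′∈))) eq))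
      where q′∈ = slide⁺ 0F (third u′∈)

    flipped : ∀ {q} → q ∈ move₃ (0 , t , u , 0F) →
      ∃[ r ] r ∈ move₃ (1 , t , u , 0F) ×
             flip (value q) ≡ value r
    flipped q∈ with option (0 , t , u) 0F q∈
    ... | slide (second t′∈) =
      _ , slide⁺ 0F (second t′∈) , sym (go _ u (rs q∈))
    ... | slide (third u′∈) =
      _ , slide⁺ 0F (third u′∈) , sym (go t _ (rs q∈))

𝒢-one₂ : ∀ s u → 𝒢 (s , 1 , u) 0F ≡ flip (𝒢 (s , 0 , u) 0F)
𝒢-one₂ s u = trans (𝒢-swap₁₂ 1 s u 0F)
  (trans (𝒢-one s u) (cong flip (𝒢-swap₁₂ s 0 u 0F)))

𝒢-one₃ : ∀ s t → 𝒢 (s , t , 1) 0F ≡ flip (𝒢 (s , t , 0) 0F)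
𝒢-one₃ s t = trans (𝒢-swap₂₃ s 1 t 0F)
  (trans (𝒢-one₂ s t) (cong flip (𝒢-swap₂₃ s t 0 0F)))

-- The pass with two non-empty piles

Multi : Piles → Set
Multi (s , t , u) = (s > 0 × t > 0) ⊎ (t > 0 × u > 0) ⊎ (u > 0 × s > 0)

total>0 : ∀ {s t u} → s > 0 ⊎ t > 0 ⊎ u > 0 → total (s , t , u) > 0
total>0 {s} {t} {u} (inj₁ s>0) =
  <-≤-trans s>0 (≤-trans (m≤m+n s t) (m≤m+n (s + t) u))
total>0 {s} {t} {u} (inj₂ (inj₁ t>0)) =
  <-≤-trans t>0 (≤-trans (m≤n+m t s) (m≤m+n (s + t) u))
total>0 {s} {t} {u} (inj₂ (inj₂ u>0)) = <-≤-trans u>0 (m≤n+m u (s + t))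

Multi⇒total>0 : ∀ {x} → Multi x → total x > 0
Multi⇒total>0 = total>0 ∘ Sum.map proj₁ (Sum.map proj₁ proj₁)

-- Only emptying a pile can leave fewer than two non-empty ones. That pile had exactly one stone, so
-- `𝒢-one` and its permuted forms apply, and some other pile is still non-empty.
Multi-slide : ∀ {x y} → Multi x → x ⟶ y →
              Multi y ⊎ (total y > 0 × 𝒢 x 0F ≡ flip (𝒢 y 0F))
Multi-slide multi (first {s} {zero} 0∈) with 0∈removals⇒≡1 s 0∈
... | refl = inj₂ (total>0 (inj₂ (nonempty multi)) , 𝒢-one _ _)
  where
  nonempty : ∀ {t u} → Multi (1 , t , u) → t > 0 ⊎ u > 0
  nonempty (inj₁ (_ , t>0))        = inj₁ t>0
  nonempty (inj₂ (inj₁ (t>0 , _))) = inj₁ t>0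
  nonempty (inj₂ (inj₂ (u>0 , _))) = inj₂ u>0
Multi-slide multi (second {t = t} {zero} 0∈) with 0∈removals⇒≡1 t 0∈
... | refl = inj₂ (total>0 (nonempty multi) , 𝒢-one₂ _ _)
  where
  nonempty : ∀ {s u} → Multi (s , 1 , u) → s > 0 ⊎ 0 > 0 ⊎ u > 0
  nonempty (inj₁ (s>0 , _))        = inj₁ s>0
  nonempty (inj₂ (inj₁ (_ , u>0))) = inj₂ (inj₂ u>0)
  nonempty (inj₂ (inj₂ (u>0 , _))) = inj₂ (inj₂ u>0)
Multi-slide multi (third {u = u} {zero} 0∈) with 0∈removals⇒≡1 u 0∈
... | refl = inj₂ (total>0 (nonempty multi) , 𝒢-one₃ _ _)
  where
  nonempty : ∀ {s t} → Multi (s , t , 1) → s > 0 ⊎ t > 0 ⊎ 0 > 0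
  nonempty (inj₁ (s>0 , _))        = inj₁ s>0
  nonempty (inj₂ (inj₁ (t>0 , _))) = inj₂ (inj₁ t>0)
  nonempty (inj₂ (inj₂ (_ , s>0))) = inj₁ s>0
Multi-slide multi (first {s′ = suc _} _) = inj₁
  (Sum.map (λ (_ , t>0) → z<s , t>0) (Sum.map₂ (λ (u>0 , _) → u>0 , z<s)) multi)
Multi-slide multi (second {t′ = suc _} _) = inj₁
  (Sum.map (λ (s>0 , _) → s>0 , z<s) (Sum.map₁ (λ (_ , u>0) → z<s , u>0)) multi)
Multi-slide multi (third {u′ = suc _} _) = inj₁
  (Sum.map₂ (Sum.map (λ (t>0 , _) → t>0 , z<s) (λ (_ , s>0) → z<s , s>0)) multi)

pass-flip : ∀ {x} → Multi x → 𝒢 x 1F ≡ flip (𝒢 x 0F)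
pass-flip {x} = go x (ImpartialGame.move-wf threePile _)
  where
  -- The induction follows the game without the pass, since the hypothesis is only invoked after a
  -- stone removal.
  go : ∀ x → Acc (ImpartialGame._◁_ threePile) (x at 0F) →
       Multi x → 𝒢 x 1F ≡ flip (𝒢 x 0F)
  go x (acc rs) multi = value-flip avoids flipped (_ , pass⁺ x>0 , refl)
    where
    x>0 : total x > 0
    x>0 = Multi⇒total>0 multi

    avoids : ∀ {q} → q ∈ move₃ (x at 1F) →
             value q ≢ flip (𝒢 x 0F)
    avoids q∈ eq with option x 1F q∈
    ... | pass _ = n≢flip[n] _ eq
    ... | slide {y = y} x⟶y with Multi-slide multi x⟶y
    ...   | inj₁ multi-y = value-option-≢ y∈
              (flip-injective (trans (sym (go y (rs y∈) multi-y)) eq))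
      where y∈ = slide⁺ 0F x⟶y
    -- Here `flip (𝒢 x 0F)` is `𝒢 y 0F`, which `𝒢 y 1F` cannot equal because passing leads from
    -- `y at 1F` to `y at 0F`.
    ...   | inj₂ (y>0 , x≡flip[y]) = value-option-≢ (pass⁺ y>0) (sym
              (trans eq (trans (cong flip x≡flip[y]) (flip-involutive (𝒢 y 0F)))))

    flipped : ∀ {q} → q ∈ move₃ (x at 0F) →
      ∃[ r ] r ∈ move₃ (x at 1F) ×
             flip (value q) ≡ value r
    flipped q∈ with option x 0F q∈
    ... | slide {y = y} x⟶y with Multi-slide multi x⟶y
    ...   | inj₁ multi-y = _ , slide⁺ 1F x⟶y , sym (go y (rs q∈) multi-y)
    -- The flipped value of `y` is `𝒢 x 0F`, so the pass from `x` realises it instead of the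
    -- removal.
    ...   | inj₂ (_ , x≡flip[y]) = _ , pass⁺ x>0 , sym x≡flip[y]

-- Transfer from the opaque values to `𝒢₃` and `𝒢₁`

𝒢≡𝒢₃ : ∀ s t u p → 𝒢 (s , t , u) p ≡ 𝒢₃ s t u p
𝒢≡𝒢₃ s t u p = value≡grundy (s , t , u , p)

𝒢₃-pass-flip : ∀ {s t u m n} → Multi (s , t , u) → flip m ≡ n →
               𝒢₃ s t u 0F ≡ m → 𝒢₃ s t u 1F ≡ n
𝒢₃-pass-flip {s} {t} {u} {m} {n} multi flip[m]≡n 𝒢≡m = begin
  𝒢₃ s t u 1F                ≡⟨ 𝒢≡𝒢₃ s t u 1F ⟨
  𝒢 (s , t , u) 1F           ≡⟨ pass-flip multi ⟩
  flip (𝒢 (s , t , u) 0F)    ≡⟨ cong flip (trans (𝒢≡𝒢₃ s t u 0F) 𝒢≡m) ⟩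
  flip m                     ≡⟨ flip[m]≡n ⟩
  n                          ∎
  where open ≡-Reasoning

theorem4 : (∀ (s : ℕ) →
    𝒢₃ s 0 0 1F ≡ 𝒢₃ 0 s 0 1F
    × 𝒢₃ 0 s 0 1F ≡ 𝒢₃ 0 0 s 1F
    × 𝒢₃ 0 0 s 1F ≡ 𝒢₁ s 1F)
    ×
    (∀ (s t u : ℕ) →
    (s > 0 × t > 0) ⊎ (t > 0 × u > 0) ⊎ (u > 0 × s > 0) →
    (∀ (m : ℕ) → 𝒢₃ s t u 0F ≡ 2 * m → 𝒢₃ s t u 1F ≡ 2 * m + 1)
    × (∀ (m : ℕ) → 𝒢₃ s t u 0F ≡ 2 * m + 1 → 𝒢₃ s t u 1F ≡ 2 * m))
theorem4 =
    (λ s → subst₂ _≡_ (𝒢≡𝒢₃ s 0 0 1F) (𝒢≡𝒢₃ 0 s 0 1F) (𝒢-swap₁₂ 0 s 0 1F)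
         , subst₂ _≡_ (𝒢≡𝒢₃ 0 s 0 1F) (𝒢≡𝒢₃ 0 0 s 1F) (𝒢-swap₂₃ 0 0 s 1F)
         , subst₂ _≡_ (𝒢≡𝒢₃ 0 0 s 1F) (Grundy.value≡grundy onePile (s , 1F))
             (𝒢-single s 1F))
  , λ s t u multi → (λ m → 𝒢₃-pass-flip multi (flip-even m))
                  , (λ m → 𝒢₃-pass-flip multi (flip-odd m))
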